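{- Assume the $abc$-conjecture: for every $\delta > 0$ there is a constant $K_\delta$ such that for all triples $(A,B,C)$ of pairwise co-prime positive integers with $A + B = C$ one has $C < K_\delta\, \kappa(ABC)^{1+\delta}$, where $\kappa(n) = \prod_{p \mid n} p$ (product over the distinct primes dividing $n$) is the squarefree kernel of $n$. Let $l$ be a non-zero integer and let $\epsilon$ be a real number with $0 < \epsilon < 2/5$. Then there exists a constant $C_{\epsilon,l} > 0$, depending only on $\epsilon$ and $l$, such that whenever $a, b$ are positive integers with $1 \le a < b$ and \[ a^2(a^2+l) \mid b^2(b^2+l), \] we have \[ b \ge C_{\epsilon,l}\, a^{8/7 - \epsilon}. \] -}

module Defs where

open import Data.Nat using (ℕ; suc; _+_; _*_; _^_; _<_; _≤_)
open import Data.Nat.Divisibility using (_∣?_)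
open import Data.Nat.Primality using (prime?)
open import Data.Nat.Coprimality using (Coprime)
open import Data.List using (List; filter; upTo)
open import Data.Nat.ListAction using (product)
open import Data.Product using (_×_; ∃)
open import Relation.Nullary.Decidable using (_×-dec_)

-- squarefree kernel κ(n) = product of the distinct primes p dividing n
-- (primes dividing n ≥ 1 are ≤ n, so we range over 0..n)
κ : ℕ → ℕ
κ n = product (filter (λ p → prime? p ×-dec p ∣? n) (upTo (suc n)))

-- abc conjecture, with δ = m / n (m, n > 0) and C < K κ^{1+δ}
-- rewritten equivalently as C^n < K * κ(ABC)^(n+m), K ∈ ℕ.
ABC-Conjecture : Set
ABC-Conjecture =
  (m n : ℕ) → 0 < m → 0 < n →
  ∃ λ (K : ℕ) →
    (A B C : ℕ) → 0 < A → 0 < B → 0 < C →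
    Coprime A B → Coprime B C → Coprime A C →
    A + B ≡ C →
    C ^ n < K * κ (A * B * C) ^ (n + m)
  where open import Relation.Binary.PropositionalEquality using (_≡_)

{-# OPTIONS --safe #-}

-- Write a = eD, b = mD with D = gcd(a, b), and α = a² + l, β = b² + l. Since e and m are coprime,
-- e² ∣ β, say β = e²n. With g = gcd(α, n), α = fg and n = n′g, the quotient f divides m², say
-- m² = f f′, and t = n′f′ is the quotient b²β / a²α. The identity m²α − e²β = l(m² − e²) becomes
--   f²f′ − n′e⁴ = ±z   with   zg = |l|(m² − e²),
-- and z is coprime to e and f, while z (a² + β) = |l| e²f (t − 1); hence z ∣ l(t − 1) and z ≤ |l|t.
-- After cancelling G = gcd(f′, n′) the three terms are pairwise coprime, and every prime dividing
-- f²f′ divides m, so abc gives, up to exponents 1 + δ and constants, m³ ≪ e t². Now t ≪ (m/e)⁴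
-- and a² ≪ fg ≪ m⁴, so that a ≪ m² ≪ (m/e)⁷ = (b/a)⁷.

module Submission where

open import Defs
open import Data.Nat using (ℕ; zero; suc; pred; _+_; _*_; _^_; _<_; _≤_; _∸_; NonZero; z≤n; s≤s; >-nonZero; >-nonZero⁻¹; ≢-nonZero)
open import Data.Nat.Properties
open import Data.Nat.Divisibility using (_∣_; divides; ∣-trans; ∣⇒≤; ∣1⇒≡1; 1∣_; ∣m∣n⇒∣m+n; ∣m+n∣m⇒∣n; ∣m⇒∣m*n; ∣n⇒∣m*n; m∣m*n; n∣m*n; *-cancelˡ-∣; _∣?_)
open import Data.Nat.Coprimality as Coprimality using (Coprime; coprime-divisor)
open import Data.Nat.GCD using (GCD; mkGCD; GCD-*; module GCD)
open import Data.Nat.Primality using (Prime; prime?; euclidsLemma; prime⇒irreducible)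
open import Data.Nat.ListAction using (product)
open import Data.Nat.Tactic.RingSolver using (solve-∀)
open import Data.List using ([]; _∷_; upTo)
open import Data.List.Relation.Unary.All as All using (All; []; _∷_)
open import Data.List.Relation.Unary.All.Properties using (all-filter)
open import Data.List.Relation.Unary.AllPairs using ([]; _∷_)
open import Data.List.Relation.Unary.Unique.Propositional using (Unique)
open import Data.List.Relation.Unary.Unique.Propositional.Properties using (upTo⁺; filter⁺)
open import Data.Product using (_×_; ∃; _,_)
open import Data.Sum using (_⊎_; inj₁; inj₂; [_,_]′; swap)
open import Function using (it)
open import Relation.Nullary using (Dec; yes; no; contradiction)
open import Relation.Nullary.Decidable using (_×-dec_)
open import Data.Integer as ℤ using (ℤ; +_; -[1+_]) renaming (_*_ to _*ℤ_; _+_ to _+ℤ_)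
import Data.Integer.Properties as ℤ
import Data.Integer.Divisibility as ℤ
open import Relation.Binary.PropositionalEquality using (_≡_; _≢_; refl; sym; trans; cong; cong₂; subst; subst₂; module ≡-Reasoning)

-- Coprimality of products

coprime-*ʳ : ∀ {k m n} → Coprime k m → Coprime k n → Coprime k (m * n)
coprime-*ʳ k⊥m k⊥n (d∣k , d∣mn) =
  k⊥n (d∣k , coprime-divisor (λ (i∣d , i∣m) → k⊥m (∣-trans i∣d d∣k , i∣m)) d∣mn)

coprime-∣ʳ : ∀ {k m n} → m ∣ n → Coprime k n → Coprime k m
coprime-∣ʳ m∣n k⊥n (d∣k , d∣m) = k⊥n (d∣k , ∣-trans d∣m m∣n)

coprime-sqʳ : ∀ {m n} → Coprime m n → Coprime m (n * n)
coprime-sqʳ m⊥n = coprime-*ʳ m⊥n m⊥n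

coprime-sq : ∀ {m n} → Coprime m n → Coprime (m * m) (n * n)
coprime-sq m⊥n = Coprimality.sym (coprime-sqʳ (Coprimality.sym (coprime-sqʳ m⊥n)))

coprime-∣*∣ : ∀ {m n o} → Coprime m n → m ∣ o → n ∣ o → m * n ∣ o
coprime-∣*∣ {m} {n} m⊥n m∣o (divides q refl)
  with coprime-divisor m⊥n (subst (m ∣_) (*-comm q n) m∣o)
... | divides r refl = divides r (*-assoc r m n)

-- Distinct primes and the squarefree kernel

prime-factor⇒≡ : ∀ {p q} → Prime p → Prime q → p ∣ q → p ≡ q
prime-factor⇒≡ pp pq p∣q with prime⇒irreducible pq p∣q
... | inj₁ refl = contradiction pp λ ()
... | inj₂ p≡q  = p≡q

distinct-primes⇒coprime : ∀ {p q} → Prime p → Prime q → p ≢ q → Coprime p q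
distinct-primes⇒coprime pp pq p≢q (d∣p , d∣q) with prime⇒irreducible pp d∣p
... | inj₁ d≡1  = d≡1
... | inj₂ refl = contradiction (prime-factor⇒≡ pp pq d∣q) p≢q

-- Induction on the list: the head is coprime to each later prime, hence to their product, so the
-- two divisors of `r` multiply.
product-distinct-primes-∣ : ∀ {r ps} → Unique ps → All (λ p → Prime p × p ∣ r) ps → product ps ∣ r
product-distinct-primes-∣ [] [] = 1∣ _
product-distinct-primes-∣ {r} {p ∷ ps} (p∉ps ∷ u) ((pp , p∣r) ∷ all) =
  coprime-∣*∣ (coprime-product p∉ps all) p∣r (product-distinct-primes-∣ u all)
  where
  coprime-product : ∀ {qs} → All (p ≢_) qs → All (λ q → Prime q × q ∣ r) qs → Coprime p (product qs)
  coprime-product [] [] (_ , d∣1) = ∣1⇒≡1 d∣1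
  coprime-product (p≢q ∷ p≢qs) ((pq , _) ∷ rest) =
    coprime-*ʳ (distinct-primes⇒coprime pp pq p≢q) (coprime-product p≢qs rest)

-- `κ` enters the proof only through this upper bound, so `r` may be any convenient number that the
-- primes divide. The filtered list has no repetitions because `upTo` has none.
κ≤ : ∀ n {r} .{{_ : NonZero r}} → (∀ {p} → Prime p → p ∣ n → p ∣ r) → κ n ≤ r
κ≤ n h = ∣⇒≤ (product-distinct-primes-∣
  (filter⁺ P? (upTo⁺ (suc n)))
  (All.map (λ (pp , p∣n) → pp , h pp p∣n) (all-filter P? (upTo (suc n)))))
  where P? = λ p → prime? p ×-dec p ∣? n

-- Reduction by a gcd, and unsigned differences

record Reduced (x y : ℕ) : Set where
  constructor reduced
  field
    g x′ y′ : ℕ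
    x≡ : x ≡ x′ * g
    y≡ : y ≡ y′ * g
    x′⊥y′ : Coprime x′ y′

reduce : ∀ x y .{{_ : NonZero x}} → Reduced x y
reduce x y with mkGCD x y
... | g , isG with GCD.commonDivisor isG
-- The gcd of `x′ * g` and `y′ * g` is `1 * g`; `GCD-*` cancels the factor `g`.
... | divides x′ refl , divides y′ refl = reduced g x′ y′ refl refl
  (Coprimality.GCD≡1⇒coprime (GCD-* {{m*n≢0⇒n≢0 x′}} (subst (GCD _ _) (sym (*-identityˡ g)) isG)))

-- z = |x − y|, without fixing the sign, so that both signs of l are treated at once.
Gap : ℕ → ℕ → ℕ → Set
Gap x y z = x ≡ y + z ⊎ y ≡ x + z

gap-∣ˡ : ∀ {x y z d} → Gap x y z → d ∣ y → d ∣ z → d ∣ x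
gap-∣ˡ (inj₁ refl) d∣y d∣z = ∣m∣n⇒∣m+n d∣y d∣z
gap-∣ˡ {x} {z = z} {d} (inj₂ refl) d∣y d∣z = ∣m+n∣m⇒∣n (subst (d ∣_) (+-comm x z) d∣y) d∣z

gap-∣ : ∀ {x y z d} → Gap x y z → d ∣ x → d ∣ y → d ∣ z
gap-∣ (inj₁ refl) d∣x d∣y = ∣m+n∣m⇒∣n d∣x d∣y
gap-∣ (inj₂ refl) d∣x d∣y = ∣m+n∣m⇒∣n d∣y d∣x

gap-cancel : ∀ {x y z} g .{{_ : NonZero g}} → Gap (x * g) (y * g) (z * g) → Gap x y z
gap-cancel {x} {y} {z} g (inj₁ e) = inj₁ (*-cancelʳ-≡ x (y + z) g (trans e (sym (*-distribʳ-+ g y z))))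
gap-cancel {x} {y} {z} g (inj₂ e) = inj₂ (*-cancelʳ-≡ y (x + z) g (trans e (sym (*-distribʳ-+ g x z))))

-- Powers and squares

^-distribʳ-* : ∀ m n k → (m * n) ^ k ≡ m ^ k * n ^ k
^-distribʳ-* m n zero    = refl
^-distribʳ-* m n (suc k) = trans (cong (m * n *_) (^-distribʳ-* m n k)) (interchange m n (m ^ k) (n ^ k))
  where
  interchange : ∀ a b c d → a * b * (c * d) ≡ a * c * (b * d)
  interchange = solve-∀

square-cancel-≤ : ∀ {m n} → m * m ≤ n * n → m ≤ n
square-cancel-≤ m²≤n² = ≮⇒≥ λ n<m → <⇒≱ (*-mono-< n<m n<m) m²≤n²

-- The abc bound for an unsigned difference

-- One instance of the conjecture, δ = k / n, with its constant already chosen, so that later bounds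
-- can name that constant.
ABCBound : (k n K : ℕ) → Set
ABCBound k n K = (A B C : ℕ) → 0 < A → 0 < B → 0 < C →
  Coprime A B → Coprime B C → Coprime A C →
  A + B ≡ C → C ^ n < K * κ (A * B * C) ^ (n + k)

-- The larger of `x` and `y` plays C, so the two signs differ only in the order of the terms. The
-- bound on C passes to `x`, and `R` replaces the kernel.
gap-abc : ∀ k n K → ABCBound k n K →
  ∀ {x y z R} .{{_ : NonZero x}} .{{_ : NonZero y}} .{{_ : NonZero z}} .{{_ : NonZero R}} →
  Gap x y z → Coprime x y →
  (∀ {p} → Prime p → p ∣ x ⊎ p ∣ y ⊎ p ∣ z → p ∣ R) →
  x ^ n ≤ K * R ^ (n + k)
gap-abc k n K abc {x} {y} {z} {R} gap x⊥y rad = case gap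
  where
  x⊥z : Coprime x z
  x⊥z (d∣x , d∣z) = x⊥y (d∣x , gap-∣ˡ (swap gap) d∣x d∣z)
  y⊥z : Coprime y z
  y⊥z (d∣y , d∣z) = x⊥y (gap-∣ˡ gap d∣y d∣z , d∣y)
  0<x = >-nonZero⁻¹ x
  0<y = >-nonZero⁻¹ y
  0<z = >-nonZero⁻¹ z
  split : ∀ {p} A B C → Prime p → p ∣ A * B * C → p ∣ A ⊎ p ∣ B ⊎ p ∣ C
  split A B C pp p∣ with euclidsLemma (A * B) C pp p∣
  ... | inj₂ p∣C = inj₂ (inj₂ p∣C)
  ... | inj₁ p∣AB with euclidsLemma A B pp p∣AB
  ...   | inj₁ p∣A = inj₁ p∣A
  ...   | inj₂ p∣B = inj₂ (inj₁ p∣B)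
  bound : ∀ w → (∀ {p} → Prime p → p ∣ w → p ∣ R) → K * κ w ^ (n + k) ≤ K * R ^ (n + k)
  bound w h = *-monoʳ-≤ K (^-monoˡ-≤ (n + k) (κ≤ w h))
  case : Gap x y z → x ^ n ≤ K * R ^ (n + k)
  case (inj₁ x≡y+z) = ≤-trans
    (<⇒≤ (abc y z x 0<y 0<z 0<x y⊥z (Coprimality.sym x⊥z) (Coprimality.sym x⊥y) (sym x≡y+z)))
    (bound (y * z * x) λ pp p∣ →
      rad pp ([ (λ h → inj₂ (inj₁ h)) , [ (λ h → inj₂ (inj₂ h)) , inj₁ ]′ ]′ (split y z x pp p∣)))
  case (inj₂ y≡x+z) = ≤-trans (^-monoˡ-≤ n (subst (x ≤_) (sym y≡x+z) (m≤m+n x z)))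
    (≤-trans
      (<⇒≤ (abc x z y 0<x 0<z 0<y x⊥z (Coprimality.sym y⊥z) x⊥y (sym y≡x+z)))
      (bound (x * z * y) λ pp p∣ →
        rad pp ([ inj₁ , [ (λ h → inj₂ (inj₂ h)) , (λ h → inj₂ (inj₁ h)) ]′ ]′ (split x z y pp p∣))))

-- The coprime triple

-- In the notation of the header, x = f²f′/G, y = n′e⁴/G and z is the header's z divided by G;
-- R is a multiple of the kernel of xyz, and the factor s = G f′ completes x to m⁴.
record Triple (L e m P α β : ℕ) : Set where
  field
    x y z R s t : ℕ
    {{x≢0}} : NonZero x
    {{y≢0}} : NonZero y
    {{z≢0}} : NonZero z
    {{R≢0}} : NonZero R
    {{s≢0}} : NonZero s
    gap  : Gap x y z
    x⊥y  : Coprime x y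
    rad  : ∀ {p} → Prime p → p ∣ x ⊎ p ∣ y ⊎ p ∣ z → p ∣ R
    x*s≡m⁴ : x * s ≡ (m * m) * (m * m)
    R*s≤ : R * s ≤ L * (m * e * (t * t))
    t≡ : t * (e * e * α) ≡ m * m * β
    α≤ : α ≤ m * m * (L * P)

prime∣sq⇒∣ : ∀ {p} m → Prime p → p ∣ m * m → p ∣ m
prime∣sq⇒∣ m pp p∣ = [ (λ h → h) , (λ h → h) ]′ (euclidsLemma m m pp p∣)

-- Cancelling e²g leaves f ∣ n m², and `f` is coprime to `n`.
coprime-cofactor-∣ : ∀ {e f g m n} .{{_ : NonZero e}} .{{_ : NonZero (f * g)}} → Coprime f n →
  e * e * (f * g) ∣ m * m * (n * g * (e * e)) → f ∣ m * m
coprime-cofactor-∣ {e} {f} {g} {m} {n} f⊥n div =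
  coprime-divisor f⊥n (*-cancelˡ-∣ (e * e * g) (subst₂ _∣_ (lhs e f g) (rhs e m n g) div))
  where
  instance
    _ = m*n≢0 (e * e) g {{m*n≢0 e e}} {{m*n≢0⇒n≢0 f}}
  lhs : ∀ e f g → e * e * (f * g) ≡ e * e * g * f
  lhs = solve-∀
  rhs : ∀ e m n g → m * m * (n * g * (e * e)) ≡ e * e * g * (n * (m * m))
  rhs = solve-∀

-- Replacing m² by f′f exposes `g` as a common factor of both terms, ready to be cancelled.
gap-extract : ∀ {e f f′ g m n Z} → m * m ≡ f′ * f → Gap (m * m * (f * g)) (e * e * (n * g * (e * e))) Z →
  Gap (f * f * f′ * g) (n * (e * e * (e * e)) * g) Z
gap-extract {e} {f} {f′} {g} {m} {n} {Z} m²≡f′f = subst₂ (λ u v → Gap u v Z)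
  (trans (cong (_* (f * g)) m²≡f′f) (eqˣ f f′ g)) (eqʸ e n g)
  where
  eqˣ : ∀ f f′ g → f′ * f * (f * g) ≡ f * f * f′ * g
  eqˣ = solve-∀
  eqʸ : ∀ e n g → e * e * (n * g * (e * e)) ≡ n * (e * e * (e * e)) * g
  eqʸ = solve-∀

gap-quotient : ∀ {x y z g Z} .{{_ : NonZero g}} → Z ≡ z * g → Gap (x * g) (y * g) Z → Gap x y z
gap-quotient refl = gap-cancel _

square≢0 : ∀ {e n P} .{{_ : NonZero e}} → n ≡ e * e + P → NonZero n
square≢0 {e} {n} {P} eq = subst NonZero (sym eq) (>-nonZero (≤-trans (>-nonZero⁻¹ (e * e) {{m*n≢0 e e}}) (m≤m+n (e * e) P)))

triple : ∀ {L D e m P α β}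
  .{{_ : NonZero L}} .{{_ : NonZero e}} .{{_ : NonZero P}} .{{_ : NonZero α}} .{{_ : NonZero β}} →
  Coprime e m → m * m ≡ e * e + P → β ≡ α + D * D * P →
  Gap (m * m * α) (e * e * β) (L * P) → e * e * α ∣ m * m * β →
  Triple L e m P α β
triple {L} {D} {e} {m} {P} {α} {β} e⊥m m²≡ β≡ gap₀ div
  -- As e² is coprime to m², it divides `β`, which becomes `n * (e * e)`; reducing `α` against `n`
  -- then yields f, g and n′.
  with coprime-divisor (coprime-sq e⊥m) (∣-trans (m∣m*n α) div)
... | divides n refl with reduce α n
... | reduced g f n′ refl refl f⊥n′ with coprime-cofactor-∣ {e} {f} {g} {m} f⊥n′ div
... | f∣m²@(divides f′ m²≡f′f) with gap-extract {e} {f} {f′} {g} {m} {n′} m²≡f′f gap₀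
-- `g` divides both terms, hence their difference `L * P`; the quotient `z₀` is the header's z.
... | gap₀g with gap-∣ gap₀g (n∣m*n (f * f * f′)) (n∣m*n (n′ * (e * e * (e * e))))
... | g∣LP@(divides z₀ LP≡z₀g)
  with gap-quotient {f * f * f′} {n′ * (e * e * (e * e))} {z₀} {g} {{m*n≢0⇒n≢0 f}} LP≡z₀g gap₀g
     | reduce f′ n′ {{m*n≢0⇒m≢0 f′ {f} {{subst NonZero m²≡f′f (square≢0 m²≡)}}}}
-- `f` is coprime to n′ and e, and `e` to f′, so removing `G` from f′ and n′ suffices to make the
-- two terms coprime.
... | gap₁ | reduced G f″ n″ f′≡f″G n′≡n″G f″⊥n″
  with gap-∣ gap₁ (∣n⇒∣m*n (f * f) (divides f″ f′≡f″G)) (∣m⇒∣m*n (e * e * (e * e)) (divides n″ n′≡n″G))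
... | divides z z₀≡zG = record
  { x = x ; y = y ; z = z ; R = m * n″ * e * z ; s = G * f′ ; t = t
  ; x≢0 = m*n≢0 (f * f) f″ {{m*n≢0 f f}}
  ; y≢0 = m*n≢0 n″ (e * e * (e * e)) {{it}} {{m*n≢0 (e * e) (e * e)}}
  ; R≢0 = m*n≢0 (m * n″ * e) z {{m*n≢0 (m * n″) e {{m*n≢0 m n″}}}}
  ; s≢0 = m*n≢0 G f′
  ; gap = gap-quotient {g = G} z₀≡zG (subst₂ (λ u v → Gap u v z₀) x₀≡xG y₀≡yG gap₁)
  ; x⊥y = Coprimality.sym (coprime-*ʳ (coprime-sqʳ y⊥f) y⊥f″)
  ; rad = rad
  ; x*s≡m⁴ = x*s≡m⁴
  ; R*s≤ = R*s≤
  ; t≡ = t-eq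
  ; α≤ = *-mono-≤ (∣⇒≤ f∣m²) (∣⇒≤ g∣LP)
  }
  where
  β₀ : ℕ
  β₀ = n′ * g * (e * e)

  instance
    g≢0 : NonZero g
    g≢0 = m*n≢0⇒n≢0 f
    f≢0 : NonZero f
    f≢0 = m*n≢0⇒m≢0 f
    n≢0 : NonZero (n′ * g)
    n≢0 = m*n≢0⇒m≢0 (n′ * g)
    n′≢0 : NonZero n′
    n′≢0 = m*n≢0⇒m≢0 n′
    e²≢0 : NonZero (e * e)
    e²≢0 = m*n≢0 e e
    m²≢0 : NonZero (m * m)
    m²≢0 = square≢0 m²≡
    m≢0 : NonZero m
    m≢0 = m*n≢0⇒m≢0 m
    LP≢0 : NonZero (L * P)
    LP≢0 = m*n≢0 L P

  f′∣m² : f′ ∣ m * m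
  f′∣m² = subst (f′ ∣_) (sym m²≡f′f) (m∣m*n f)

  t : ℕ
  t = n′ * f′
  instance
    f′≢0 : NonZero f′
    f′≢0 = m*n≢0⇒m≢0 f′ {f} {{subst NonZero m²≡f′f m²≢0}}
    t≢0 : NonZero t
    t≢0 = m*n≢0 n′ f′

  t-eq : t * (e * e * (f * g)) ≡ m * m * β₀
  t-eq = trans (eq e f f′ g n′) (cong (_* β₀) (sym m²≡f′f))
    where
    eq : ∀ e f f′ g n′ → n′ * f′ * (e * e * (f * g)) ≡ f′ * f * (n′ * g * (e * e))
    eq = solve-∀

  e⊥f : Coprime e f
  e⊥f = coprime-∣ʳ f∣m² (coprime-sqʳ e⊥m)
  e⊥f′ : Coprime e f′
  e⊥f′ = coprime-∣ʳ f′∣m² (coprime-sqʳ e⊥m)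

  x₀ y₀ : ℕ
  x₀ = f * f * f′
  y₀ = n′ * (e * e * (e * e))

  -- A common divisor divides y₀ = n′e⁴, hence x₀ = f²f′, whose factors are coprime to `e`.
  z₀⊥e : Coprime z₀ e
  z₀⊥e (d∣z , d∣e) = coprime-*ʳ (coprime-sqʳ e⊥f) e⊥f′
    (d∣e , gap-∣ˡ gap₁ (∣n⇒∣m*n n′ (∣m⇒∣m*n (e * e) (∣m⇒∣m*n e d∣e))) d∣z)
  -- Here the common divisor passes from x₀ to y₀ instead, and `f` is coprime to n′ and e.
  z₀⊥f : Coprime z₀ f
  z₀⊥f (d∣z , d∣f) = coprime-*ʳ f⊥n′ (coprime-sqʳ (coprime-sqʳ (Coprimality.sym e⊥f)))
    (d∣f , gap-∣ˡ (swap gap₁) (∣m⇒∣m*n f′ (∣m⇒∣m*n f d∣f)) d∣z)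

  -- With a = eD this is the header's a² + β.
  S : ℕ
  S = D * D * (e * e) + β₀

  instance
    z₀≢0 : NonZero z₀
    z₀≢0 = m*n≢0⇒m≢0 z₀ {g} {{subst NonZero LP≡z₀g LP≢0}}
    S≢0 : NonZero S
    S≢0 = >-nonZero (≤-trans (>-nonZero⁻¹ β₀) (m≤n+m _ (D * D * (e * e))))

  -- In t e²α = m²β, inserting m² = e² + P and β = α + D²P leaves e²α plus a multiple of `P`. Adding
  -- e²α to both sides avoids truncated subtraction.
  t-1-eq : e * e * (f * g) * pred t ≡ P * S
  t-1-eq = +-cancelˡ-≡ (e * e * (f * g)) _ _ (begin
    e * e * (f * g) + e * e * (f * g) * pred t  ≡⟨ *-suc (e * e * (f * g)) (pred t) ⟨
    e * e * (f * g) * suc (pred t)              ≡⟨ cong (e * e * (f * g) *_) (suc-pred t) ⟩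
    e * e * (f * g) * t                         ≡⟨ *-comm (e * e * (f * g)) t ⟩
    t * (e * e * (f * g))                       ≡⟨ t-eq ⟩
    m * m * β₀                                  ≡⟨ cong (_* β₀) m²≡ ⟩
    (e * e + P) * β₀                            ≡⟨ *-distribʳ-+ β₀ (e * e) P ⟩
    e * e * β₀ + P * β₀                         ≡⟨ cong (λ b → e * e * b + P * β₀) β≡ ⟩
    e * e * (f * g + D * D * P) + P * β₀        ≡⟨ eq e (f * g) D P β₀ ⟩
    e * e * (f * g) + P * S                     ∎)
    where
    open ≡-Reasoning
    eq : ∀ e α D P β → e * e * (α + D * D * P) + P * β ≡ e * e * α + P * (D * D * (e * e) + β)
    eq = solve-∀

  z₀S≡ : z₀ * S ≡ e * e * f * (L * pred t)
  z₀S≡ = *-cancelʳ-≡ _ _ g (begin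
    z₀ * S * g                     ≡⟨ eq₁ z₀ S g ⟩
    z₀ * g * S                     ≡⟨ cong (_* S) LP≡z₀g ⟨
    L * P * S                      ≡⟨ *-assoc L P S ⟩
    L * (P * S)                    ≡⟨ cong (L *_) t-1-eq ⟨
    L * (e * e * (f * g) * pred t) ≡⟨ eq₂ L e f g (pred t) ⟩
    e * e * f * (L * pred t) * g   ∎)
    where
    open ≡-Reasoning
    eq₁ : ∀ z a g → z * a * g ≡ z * g * a
    eq₁ = solve-∀
    eq₂ : ∀ L e f g t → L * (e * e * (f * g) * t) ≡ e * e * f * (L * t) * g
    eq₂ = solve-∀

  -- `z₀` is coprime to e²f, so by `z₀S≡` it divides L (t - 1).
  z₀≤Lt : z₀ ≤ L * t
  z₀≤Lt = ≤-trans (∣⇒≤ z₀∣) (*-monoʳ-≤ L pred[n]≤n)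
    where
    z₀∣ : z₀ ∣ L * pred t
    z₀∣ = coprime-divisor (coprime-*ʳ (coprime-sqʳ z₀⊥e) z₀⊥f) (subst (z₀ ∣_) z₀S≡ (m∣m*n S))
    -- `∣⇒≤` needs a non-zero multiple: z₀S > 0 forces t > 1.
    instance _ = m*n≢0⇒n≢0 (e * e * f) {{subst NonZero z₀S≡ (m*n≢0 z₀ S)}}

  instance
    G≢0 : NonZero G
    G≢0 = m*n≢0⇒n≢0 f″ {{subst NonZero f′≡f″G f′≢0}}
    f″≢0 : NonZero f″
    f″≢0 = m*n≢0⇒m≢0 f″ {{subst NonZero f′≡f″G f′≢0}}
    n″≢0 : NonZero n″
    n″≢0 = m*n≢0⇒m≢0 n″ {{subst NonZero n′≡n″G n′≢0}}
    z≢0 : NonZero z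
    z≢0 = m*n≢0⇒m≢0 z {G} {{subst NonZero z₀≡zG z₀≢0}}

  n″∣n′ : n″ ∣ n′
  n″∣n′ = subst (n″ ∣_) (sym n′≡n″G) (m∣m*n G)
  f″∣f′ : f″ ∣ f′
  f″∣f′ = subst (f″ ∣_) (sym f′≡f″G) (m∣m*n G)

  x y : ℕ
  x = f * f * f″
  y = n″ * (e * e * (e * e))

  x₀≡xG : x₀ ≡ x * G
  x₀≡xG = trans (cong (f * f *_) f′≡f″G) (sym (*-assoc (f * f) f″ G))
  y₀≡yG : y₀ ≡ y * G
  y₀≡yG = trans (cong (_* (e * e * (e * e))) n′≡n″G) (eq n″ G (e * e * (e * e)))
    where
    eq : ∀ n G E → n * G * E ≡ n * E * G
    eq = solve-∀

  y⊥f : Coprime y f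
  y⊥f = Coprimality.sym
    (coprime-*ʳ (coprime-∣ʳ n″∣n′ f⊥n′) (coprime-sqʳ (coprime-sqʳ (Coprimality.sym e⊥f))))
  y⊥f″ : Coprime y f″
  y⊥f″ = Coprimality.sym
    (coprime-*ʳ f″⊥n″ (coprime-sqʳ (coprime-sqʳ (Coprimality.sym (coprime-∣ʳ f″∣f′ e⊥f′)))))

  x*s≡m⁴ : x * (G * f′) ≡ m * m * (m * m)
  x*s≡m⁴ = begin
    f * f * f″ * (G * f′)   ≡⟨ eq₁ f f″ G f′ ⟩
    f * f * (f″ * G * f′)   ≡⟨ cong (λ u → f * f * (u * f′)) f′≡f″G ⟨
    f * f * (f′ * f′)       ≡⟨ eq₂ f f′ ⟩
    f′ * f * (f′ * f)       ≡⟨ cong₂ _*_ m²≡f′f m²≡f′f ⟨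
    m * m * (m * m)         ∎
    where
    open ≡-Reasoning
    eq₁ : ∀ f f″ G f′ → f * f * f″ * (G * f′) ≡ f * f * (f″ * G * f′)
    eq₁ = solve-∀
    eq₂ : ∀ f f′ → f * f * (f′ * f′) ≡ f′ * f * (f′ * f)
    eq₂ = solve-∀

  -- The factor `G` of s restores z₀ = zG, which is at most Lt, and the remaining n″f′ is at most
  -- n′f′ = t.
  R*s≤ : m * n″ * e * z * (G * f′) ≤ L * (m * e * (t * t))
  R*s≤ = begin
    m * n″ * e * z * (G * f′)   ≡⟨ eq m n″ e z G f′ ⟩
    m * e * (n″ * f′ * (z * G)) ≡⟨ cong (λ u → m * e * (n″ * f′ * u)) z₀≡zG ⟨
    m * e * (n″ * f′ * z₀)      ≤⟨ *-monoʳ-≤ (m * e) (*-mono-≤ (*-monoˡ-≤ f′ (∣⇒≤ n″∣n′)) z₀≤Lt) ⟩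
    m * e * (t * (L * t))       ≡⟨ eq′ (m * e) t L ⟩
    L * (m * e * (t * t))       ∎
    where
    open ≤-Reasoning
    eq : ∀ m n″ e z G f′ → m * n″ * e * z * (G * f′) ≡ m * e * (n″ * f′ * (z * G))
    eq = solve-∀
    eq′ : ∀ k t L → k * (t * (L * t)) ≡ L * (k * (t * t))
    eq′ = solve-∀

  rad : ∀ {p} → Prime p → p ∣ x ⊎ p ∣ y ⊎ p ∣ z → p ∣ m * n″ * e * z
  rad pp (inj₂ (inj₂ p∣z)) = ∣n⇒∣m*n (m * n″ * e) p∣z
  rad pp (inj₂ (inj₁ p∣y)) with euclidsLemma n″ _ pp p∣y
  ... | inj₁ p∣n″ = ∣m⇒∣m*n z (∣m⇒∣m*n e (∣n⇒∣m*n m p∣n″))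
  ... | inj₂ p∣e⁴ = ∣m⇒∣m*n z (∣n⇒∣m*n (m * n″) (prime∣sq⇒∣ e pp (prime∣sq⇒∣ (e * e) pp p∣e⁴)))
  rad pp (inj₁ p∣x) = ∣m⇒∣m*n z (∣m⇒∣m*n e (∣m⇒∣m*n n″ (prime∣sq⇒∣ m pp p∣m²)))
    where
    p∣m² = [ (λ p∣f² → ∣-trans (prime∣sq⇒∣ f pp p∣f²) f∣m²)
           , (λ p∣f″ → ∣-trans p∣f″ (∣-trans f″∣f′ f′∣m²)) ]′ (euclidsLemma (f * f) f″ pp p∣x)

-- Combining the exponents

-- abc is used with n = u + w and δ = u / n, so the kernel has exponent v = 2u + w. Eliminating t
-- gives e^(7v) ≤ C m^(5v + 4u), and a factor (m²)^w completes the last exponent to 7v, because 2v =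
-- 4u + 2w. That factor is what a ≤ c m² trades for the extra power a^w.
pow-bound : ∀ {K Q c x R s t D e m u w} .{{_ : NonZero e}} .{{_ : NonZero m}} .{{_ : NonZero s}} →
  x ^ (u + w) ≤ K * R ^ (u + w + u) →
  x * s ≡ m * m * (m * m) →
  R * s ≤ Q * (m * e * (t * t)) →
  t * (e * e * (e * e)) ≤ 4 * (m * m * (m * m)) →
  e * D ≤ c * (m * m) →
  (e * D) ^ (7 * (u + w + u) + w) ≤ c ^ w * (K * (16 * Q) ^ (u + w + u)) * (m * D) ^ (7 * (u + w + u))
pow-bound {K} {Q} {c} {x} {R} {s} {t} {D} {e} {m} {u} {w} abc xs≡ Rs≤ te⁴≤ a≤ = begin
  (e * D) ^ (7 * v + w)                     ≡⟨ ^-distribˡ-+-* (e * D) (7 * v) w ⟩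
  (e * D) ^ (7 * v) * (e * D) ^ w           ≤⟨ *-monoʳ-≤ ((e * D) ^ (7 * v)) (^-monoˡ-≤ w a≤) ⟩
  (e * D) ^ (7 * v) * (c * (m * m)) ^ w     ≡⟨ cong₂ _*_ (^-distribʳ-* e D (7 * v)) (^-distribʳ-* c (m * m) w) ⟩
  e ^ (7 * v) * D ^ (7 * v) * (c ^ w * (m * m) ^ w)
    ≡⟨ eq₁ (e ^ (7 * v)) (D ^ (7 * v)) (c ^ w) ((m * m) ^ w) ⟩
  c ^ w * (e ^ (7 * v) * (m * m) ^ w) * D ^ (7 * v)
    ≤⟨ *-monoˡ-≤ (D ^ (7 * v)) (*-monoʳ-≤ (c ^ w) step₄) ⟩
  c ^ w * (C * m ^ (7 * v)) * D ^ (7 * v)   ≡⟨ eq₂ (c ^ w) C (m ^ (7 * v)) (D ^ (7 * v)) ⟩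
  c ^ w * C * (m ^ (7 * v) * D ^ (7 * v))   ≡⟨ cong (c ^ w * C *_) (^-distribʳ-* m D (7 * v)) ⟨
  c ^ w * C * (m * D) ^ (7 * v)             ∎
  where
  open ≤-Reasoning
  n v C : ℕ
  n = u + w
  v = u + w + u
  C = K * (16 * Q) ^ v
  m⁴ : ℕ
  m⁴ = m * m * (m * m)

  eq₁ : ∀ E D c M → E * D * (c * M) ≡ c * (E * M) * D
  eq₁ = solve-∀
  eq₂ : ∀ c C M D → c * (C * M) * D ≡ c * C * (M * D)
  eq₂ = solve-∀

  step₁ : m⁴ ^ n ≤ K * (Q * (m * e * (t * t))) ^ v
  step₁ = begin
    m⁴ ^ n                          ≡⟨ cong (_^ n) xs≡ ⟨
    (x * s) ^ n                     ≡⟨ ^-distribʳ-* x s n ⟩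
    -- `R` carries the exponent v, so `s` is raised from n to v to form the product Rs.
    x ^ n * s ^ n                   ≤⟨ *-mono-≤ abc (^-monoʳ-≤ s (m≤m+n n u)) ⟩
    K * R ^ v * s ^ v               ≡⟨ *-assoc K (R ^ v) (s ^ v) ⟩
    K * (R ^ v * s ^ v)             ≡⟨ cong (K *_) (^-distribʳ-* R s v) ⟨
    K * (R * s) ^ v                 ≤⟨ *-monoʳ-≤ K (^-monoˡ-≤ v Rs≤) ⟩
    K * (Q * (m * e * (t * t))) ^ v ∎

  e⁴ m⁵ : ℕ
  e⁴ = e * e * (e * e)
  m⁵ = m⁴ * m

  -- The factor e⁸ turns t² into (te⁴)², and 16 is the square of the 4 in `te⁴≤`. The single `e` on
  -- the right later cancels against e⁸, leaving e⁷.
  te⁸≤ : Q * (m * e * (t * t)) * (e⁴ * e⁴) ≤ 16 * Q * (m⁵ * m⁴) * e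
  te⁸≤ = begin
    Q * (m * e * (t * t)) * (e⁴ * e⁴)            ≡⟨ eq Q m e t e⁴ ⟩
    Q * (m * e) * (t * e⁴ * (t * e⁴))            ≤⟨ *-monoʳ-≤ (Q * (m * e)) (*-mono-≤ te⁴≤ te⁴≤) ⟩
    Q * (m * e) * (4 * m⁴ * (4 * m⁴))            ≡⟨ eq′ Q m e m⁴ ⟩
    16 * Q * (m⁵ * m⁴) * e                       ∎
    where
    eq : ∀ Q m e t E → Q * (m * e * (t * t)) * (E * E) ≡ Q * (m * e) * (t * E * (t * E))
    eq = solve-∀
    eq′ : ∀ Q m e M → Q * (m * e) * (4 * M * (4 * M)) ≡ 16 * Q * (M * m * M) * e
    eq′ = solve-∀

  step₂ : m⁴ ^ n * e ^ (7 * v) ≤ K * (16 * Q * (m⁵ * m⁴)) ^ v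
  step₂ = *-cancelʳ-≤ _ _ (e ^ v) {{m^n≢0 e v}} (begin
    m⁴ ^ n * e ^ (7 * v) * e ^ v                          ≡⟨ *-assoc (m⁴ ^ n) (e ^ (7 * v)) (e ^ v) ⟩
    m⁴ ^ n * (e ^ (7 * v) * e ^ v)                        ≡⟨ cong (λ z → m⁴ ^ n * (z * e ^ v)) (^-*-assoc e 7 v) ⟨
    m⁴ ^ n * ((e ^ 7) ^ v * e ^ v)                        ≡⟨ cong (m⁴ ^ n *_) (^-distribʳ-* (e ^ 7) e v) ⟨
    m⁴ ^ n * (e ^ 7 * e) ^ v                              ≡⟨ cong (λ z → m⁴ ^ n * z ^ v) (eq e) ⟩
    m⁴ ^ n * (e⁴ * e⁴) ^ v                                ≤⟨ *-monoˡ-≤ ((e⁴ * e⁴) ^ v) step₁ ⟩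
    K * (Q * (m * e * (t * t))) ^ v * (e⁴ * e⁴) ^ v       ≡⟨ *-assoc K _ _ ⟩
    K * ((Q * (m * e * (t * t))) ^ v * (e⁴ * e⁴) ^ v)     ≡⟨ cong (K *_) (^-distribʳ-* _ (e⁴ * e⁴) v) ⟨
    K * (Q * (m * e * (t * t)) * (e⁴ * e⁴)) ^ v           ≤⟨ *-monoʳ-≤ K (^-monoˡ-≤ v te⁸≤) ⟩
    K * (16 * Q * (m⁵ * m⁴) * e) ^ v                      ≡⟨ cong (K *_) (^-distribʳ-* _ e v) ⟩
    K * ((16 * Q * (m⁵ * m⁴)) ^ v * e ^ v)                ≡⟨ *-assoc K _ _ ⟨
    K * (16 * Q * (m⁵ * m⁴)) ^ v * e ^ v                  ∎)
    where
    eq : ∀ e → e * (e * (e * (e * (e * (e * (e * 1)))))) * e ≡ e * e * (e * e) * (e * e * (e * e))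
    eq = solve-∀

  step₃ : e ^ (7 * v) ≤ C * (m⁵ ^ v * m⁴ ^ u)
  step₃ = *-cancelˡ-≤ (m⁴ ^ n) {{m^n≢0 m⁴ n {{m*n≢0 (m * m) (m * m) {{m*n≢0 m m}} {{m*n≢0 m m}}}}}} (begin
    m⁴ ^ n * e ^ (7 * v)                           ≤⟨ step₂ ⟩
    K * (16 * Q * (m⁵ * m⁴)) ^ v                   ≡⟨ cong (K *_) (^-distribʳ-* (16 * Q) (m⁵ * m⁴) v) ⟩
    K * ((16 * Q) ^ v * (m⁵ * m⁴) ^ v)             ≡⟨ *-assoc K _ _ ⟨
    C * (m⁵ * m⁴) ^ v                              ≡⟨ cong (C *_) (^-distribʳ-* m⁵ m⁴ v) ⟩
    C * (m⁵ ^ v * m⁴ ^ v)                          ≡⟨ cong (λ z → C * (m⁵ ^ v * z)) (^-distribˡ-+-* m⁴ n u) ⟩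
    C * (m⁵ ^ v * (m⁴ ^ n * m⁴ ^ u))               ≡⟨ eq C (m⁵ ^ v) (m⁴ ^ n) (m⁴ ^ u) ⟩
    m⁴ ^ n * (C * (m⁵ ^ v * m⁴ ^ u))               ∎)
    where
    eq : ∀ C a b c → C * (a * (b * c)) ≡ b * (C * (a * c))
    eq = solve-∀

  step₄ : e ^ (7 * v) * (m * m) ^ w ≤ C * m ^ (7 * v)
  step₄ = begin
    e ^ (7 * v) * (m * m) ^ w                           ≤⟨ *-monoˡ-≤ ((m * m) ^ w) step₃ ⟩
    C * (m⁵ ^ v * m⁴ ^ u) * (m * m) ^ w                 ≡⟨ cong (λ z → C * (m⁵ ^ v * z) * (m * m) ^ w) (^-distribʳ-* (m * m) (m * m) u) ⟩
    C * (m⁵ ^ v * ((m * m) ^ u * (m * m) ^ u)) * (m * m) ^ w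
                                                        ≡⟨ eq C (m⁵ ^ v) ((m * m) ^ u) ((m * m) ^ w) ⟩
    C * (m⁵ ^ v * ((m * m) ^ u * (m * m) ^ w * (m * m) ^ u))
      ≡⟨ cong (λ z → C * (m⁵ ^ v * (z * (m * m) ^ u))) (^-distribˡ-+-* (m * m) u w) ⟨
    C * (m⁵ ^ v * ((m * m) ^ n * (m * m) ^ u))          ≡⟨ cong (λ z → C * (m⁵ ^ v * z)) (^-distribˡ-+-* (m * m) n u) ⟨
    C * (m⁵ ^ v * (m * m) ^ v)                          ≡⟨ cong (C *_) (^-distribʳ-* m⁵ (m * m) v) ⟨
    C * (m⁵ * (m * m)) ^ v                              ≡⟨ cong (λ z → C * z ^ v) (eq′ m) ⟩
    C * (m ^ 7) ^ v                                     ≡⟨ cong (C *_) (^-*-assoc m 7 v) ⟩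
    C * m ^ (7 * v)                                     ∎
    where
    eq : ∀ C a b c → C * (a * (b * b)) * c ≡ C * (a * (b * c * b))
    eq = solve-∀
    eq′ : ∀ m → m * m * (m * m) * m * (m * m) ≡ m * (m * (m * (m * (m * (m * (m * 1))))))
    eq′ = solve-∀

-- The shifted squares a² + l and b² + l

-- α = a² + l and β = b² + l for an integer l with |l| = L.
Shifted : ℕ → ℕ → ℕ → ℕ → ℕ → Set
Shifted L a b α β = (α ≡ a * a + L × β ≡ b * b + L) ⊎ (α + L ≡ a * a × β + L ≡ b * b)

module _ {L D e m P α β : ℕ} (m²≡ : m * m ≡ e * e + P) where

  private
    e²b²≡m²a² : ∀ e m D → e * e * (m * D * (m * D)) ≡ m * m * (e * D * (e * D))
    e²b²≡m²a² = solve-∀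

    b²≡ : m * D * (m * D) ≡ e * D * (e * D) + D * D * P
    b²≡ = trans (eq₁ m D) (trans (cong (_* (D * D)) m²≡) (eq₂ e D P))
      where
      eq₁ : ∀ m D → m * D * (m * D) ≡ m * m * (D * D)
      eq₁ = solve-∀
      eq₂ : ∀ e D P → (e * e + P) * (D * D) ≡ e * D * (e * D) + D * D * P
      eq₂ = solve-∀

    m²L≡ : ∀ X → X + m * m * L ≡ X + L * P + e * e * L
    m²L≡ X = trans (cong (λ z → X + z * L) m²≡) (eq X e P L)
      where
      eq : ∀ X e P L → X + (e * e + P) * L ≡ X + L * P + e * e * L
      eq = solve-∀

    swap-tail : ∀ x y z → x + y + z ≡ x + z + y
    swap-tail = solve-∀

  -- As e²b² = m²a², only the terms in l survive, and the sign of l decides which side is larger.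
  shifted-gap : Shifted L (e * D) (m * D) α β → Gap (m * m * α) (e * e * β) (L * P)
  shifted-gap (inj₁ (refl , refl)) = inj₁ (begin
    m * m * (e * D * (e * D) + L)                      ≡⟨ *-distribˡ-+ (m * m) _ L ⟩
    m * m * (e * D * (e * D)) + m * m * L              ≡⟨ cong (_+ m * m * L) (e²b²≡m²a² e m D) ⟨
    e * e * (m * D * (m * D)) + m * m * L              ≡⟨ m²L≡ _ ⟩
    e * e * (m * D * (m * D)) + L * P + e * e * L      ≡⟨ swap-tail (e * e * (m * D * (m * D))) (L * P) (e * e * L) ⟩
    e * e * (m * D * (m * D)) + e * e * L + L * P      ≡⟨ cong (_+ L * P) (*-distribˡ-+ (e * e) _ L) ⟨
    e * e * (m * D * (m * D) + L) + L * P              ∎)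
    where open ≡-Reasoning
  shifted-gap (inj₂ (α+L≡ , β+L≡)) = inj₂ (+-cancelʳ-≡ (e * e * L) _ _ (begin
    e * e * β + e * e * L          ≡⟨ *-distribˡ-+ (e * e) β L ⟨
    e * e * (β + L)                ≡⟨ cong (e * e *_) β+L≡ ⟩
    e * e * (m * D * (m * D))      ≡⟨ e²b²≡m²a² e m D ⟩
    m * m * (e * D * (e * D))      ≡⟨ cong (m * m *_) α+L≡ ⟨
    m * m * (α + L)                ≡⟨ *-distribˡ-+ (m * m) α L ⟩
    m * m * α + m * m * L          ≡⟨ m²L≡ _ ⟩
    m * m * α + L * P + e * e * L  ∎))
    where open ≡-Reasoning

  shifted-diff : Shifted L (e * D) (m * D) α β → β ≡ α + D * D * P
  shifted-diff (inj₁ (refl , refl)) = trans (cong (_+ L) b²≡) (swap-tail (e * D * (e * D)) (D * D * P) L)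
  shifted-diff (inj₂ (α+L≡ , β+L≡)) = +-cancelʳ-≡ L _ _ (begin
    β + L                       ≡⟨ β+L≡ ⟩
    m * D * (m * D)             ≡⟨ b²≡ ⟩
    e * D * (e * D) + D * D * P ≡⟨ cong (_+ D * D * P) α+L≡ ⟨
    α + L + D * D * P           ≡⟨ swap-tail α L (D * D * P) ⟩
    α + D * D * P + L           ∎)
    where open ≡-Reasoning

-- The threshold 2L ≤ a² keeps `α` of the order of a² for negative l too: then L ≤ a² - L = α.
shifted-lower : ∀ {L a b α β} → 2 * L ≤ a * a → Shifted L a b α β → a * a ≤ 2 * α
shifted-lower {L} {a} _ (inj₁ (refl , _)) = ≤-trans (m≤m+n (a * a) L) (m≤m+n _ _)
shifted-lower {L} {a} {α = α} 2L≤a² (inj₂ (α+L≡ , _)) =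
  subst₂ _≤_ α+L≡ (cong (_+_ α) (sym (+-identityʳ α))) (+-monoʳ-≤ α L≤α)
  where
  L≤α : L ≤ α
  L≤α = +-cancelʳ-≤ L L α (subst₂ _≤_ (cong (_+_ L) (+-identityʳ L)) (sym α+L≡) 2L≤a²)

shifted-upper : ∀ {L a b α β} → L ≤ b * b → Shifted L a b α β → β ≤ 2 * (b * b)
shifted-upper {b = b} L≤b² (inj₁ (_ , refl)) = +-monoʳ-≤ (b * b) (≤-trans L≤b² (m≤m+n (b * b) 0))
shifted-upper {L} {b = b} {β = β} _ (inj₂ (_ , β+L≡)) =
  ≤-trans (subst (β ≤_) β+L≡ (m≤m+n β L)) (m≤m+n (b * b) _)

-- The bound for large a

-- With v = u + w + u the exponent of a relative to that of b is 1 + w / 7v, which equals 8/7 - 2u /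
-- 7v.
large-bound : ∀ u w K → ABCBound u (u + w) K →
  ∀ {L a b α β} .{{_ : NonZero L}} .{{_ : NonZero a}} →
  2 * L ≤ a * a → a < b → Shifted L a b α β → a * a * α ∣ b * b * β →
  a ^ (7 * (u + w + u) + w) ≤ (2 * L) ^ w * (K * (16 * L) ^ (u + w + u)) * b ^ (7 * (u + w + u))
large-bound u w K abc {L} {a} {b} {α} {β} 2L≤a² a<b sh div with reduce a b
... | reduced D e m refl refl e⊥m =
  pow-bound {K} {L} {2 * L} {x} {R} {s} {t} {D} {e} {m} {u} {w} {{e≢0}} {{m≢0}} {{s≢0}}
    (gap-abc u (u + w) K abc {{x≢0}} {{y≢0}} {{z≢0}} {{R≢0}} gap x⊥y rad) x*s≡m⁴ R*s≤ te⁴≤ a≤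
  where
  open ≤-Reasoning
  P : ℕ
  P = m * m ∸ e * e
  e<m : e < m
  e<m = *-cancelʳ-< D e m a<b
  e²<m² : e * e < m * m
  e²<m² = *-mono-< e<m e<m
  m²≡ : m * m ≡ e * e + P
  m²≡ = sym (m+[n∸m]≡n (<⇒≤ e²<m²))

  a²≤2α : e * D * (e * D) ≤ 2 * α
  a²≤2α = shifted-lower {L} {e * D} {m * D} 2L≤a² sh
  L≤b² : L ≤ m * D * (m * D)
  L≤b² = ≤-trans (m≤m+n L _) (≤-trans 2L≤a² (*-mono-≤ (<⇒≤ a<b) (<⇒≤ a<b)))
  β≤2b² : β ≤ 2 * (m * D * (m * D))
  β≤2b² = shifted-upper {L} {e * D} {m * D} L≤b² sh

  instance
    e≢0 : NonZero e
    e≢0 = m*n≢0⇒m≢0 e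
    D≢0 : NonZero D
    D≢0 = m*n≢0⇒n≢0 e
    m≢0 : NonZero m
    m≢0 = >-nonZero (≤-trans (s≤s z≤n) e<m)
    P≢0 : NonZero P
    P≢0 = >-nonZero (m<n⇒0<n∸m e²<m²)
    α≢0 : NonZero α
    α≢0 = m*n≢0⇒n≢0 2 {{>-nonZero (≤-trans (>-nonZero⁻¹ (e * D * (e * D)) {{m*n≢0 (e * D) (e * D)}}) a²≤2α)}}

  β≡ : β ≡ α + D * D * P
  β≡ = shifted-diff {L} {D} {e} {m} m²≡ sh
  instance
    β≢0 : NonZero β
    β≢0 = subst NonZero (sym β≡) (>-nonZero (≤-trans (>-nonZero⁻¹ α) (m≤m+n α _)))
    D²≢0 : NonZero (D * D)
    D²≢0 = m*n≢0 D D

  pull : ∀ e D α → e * D * (e * D) * α ≡ D * D * (e * e * α)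
  pull = solve-∀

  open Triple (triple {L} {D} {e} {m} {P} {α} {β} e⊥m m²≡ β≡ (shifted-gap {L} {D} {e} {m} m²≡ sh)
    (*-cancelˡ-∣ (D * D) (subst₂ _∣_ (pull e D α) (pull m D β) div)))

  -- t = b²β / a²α with b / a = m / e; the bounds a² ≤ 2α and β ≤ 2b² each contribute a factor 2.
  te⁴≤ : t * (e * e * (e * e)) ≤ 4 * (m * m * (m * m))
  te⁴≤ = *-cancelʳ-≤ _ _ (D * D) (begin
    t * (e * e * (e * e)) * (D * D)       ≡⟨ eq₁ t e D ⟩
    t * (e * e) * (e * D * (e * D))       ≤⟨ *-monoʳ-≤ (t * (e * e)) a²≤2α ⟩
    t * (e * e) * (2 * α)                 ≡⟨ eq₂ t e α ⟩
    2 * (t * (e * e * α))                 ≡⟨ cong (2 *_) t≡ ⟩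
    2 * (m * m * β)                       ≤⟨ *-monoʳ-≤ 2 (*-monoʳ-≤ (m * m) β≤2b²) ⟩
    2 * (m * m * (2 * (m * D * (m * D)))) ≡⟨ eq₃ m D ⟩
    4 * (m * m * (m * m)) * (D * D)       ∎)
    where
    eq₁ : ∀ t e D → t * (e * e * (e * e)) * (D * D) ≡ t * (e * e) * (e * D * (e * D))
    eq₁ = solve-∀
    eq₂ : ∀ t e α → t * (e * e) * (2 * α) ≡ 2 * (t * (e * e * α))
    eq₂ = solve-∀
    eq₃ : ∀ m D → 2 * (m * m * (2 * (m * D * (m * D)))) ≡ 4 * (m * m * (m * m)) * (D * D)
    eq₃ = solve-∀

  a≤ : e * D ≤ 2 * L * (m * m)
  a≤ = square-cancel-≤ (begin
    e * D * (e * D)                     ≤⟨ a²≤2α ⟩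
    2 * α                               ≤⟨ *-monoʳ-≤ 2 α≤ ⟩
    2 * (m * m * (L * P))               ≤⟨ *-monoʳ-≤ 2 (*-monoʳ-≤ (m * m) (*-monoʳ-≤ L (m∸n≤m (m * m) (e * e)))) ⟩
    2 * (m * m * (L * (m * m)))         ≡⟨ eq L (m * m) ⟩
    -- The constant 2L is enlarged to its square so that both sides are squares.
    2 * L * (m * m) * (m * m)           ≤⟨ *-monoʳ-≤ (2 * L * (m * m)) (m≤n*m (m * m) (2 * L) {{m*n≢0 2 L}}) ⟩
    2 * L * (m * m) * (2 * L * (m * m)) ∎)
    where
    eq : ∀ L M → 2 * (M * (L * M)) ≡ 2 * L * M * M
    eq = solve-∀

-- From integers to naturals, and the final constants

-- As |l| is at most a² and b², neither sum is negative, so absolute values lose no sign.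
shift-abs : ∀ l {a b} → ℤ.∣ l ∣ ≤ a * a → ℤ.∣ l ∣ ≤ b * b →
  Shifted ℤ.∣ l ∣ a b ℤ.∣ + a *ℤ + a +ℤ l ∣ ℤ.∣ + b *ℤ + b +ℤ l ∣
shift-abs (+ L) {a} {b} _ _ = inj₁ (eq a , eq b)
  where
  eq : ∀ a → ℤ.∣ + a *ℤ + a +ℤ + L ∣ ≡ a * a + L
  eq a = cong (λ z → ℤ.∣ z +ℤ + L ∣) (sym (ℤ.pos-* a a))
shift-abs -[1+ k ] {a} {b} L≤a² L≤b² = inj₂ (eq a L≤a² , eq b L≤b²)
  where
  eq : ∀ a → suc k ≤ a * a → ℤ.∣ + a *ℤ + a +ℤ -[1+ k ] ∣ + suc k ≡ a * a
  eq a L≤ = trans (cong (_+ suc k) (trans (cong (λ z → ℤ.∣ z +ℤ -[1+ k ] ∣) (sym (ℤ.pos-* a a))) (cong ℤ.∣_∣ (ℤ.⊖-≥ L≤))))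
    (m∸n+n≡m L≤)

-- Integer divisibility is divisibility of absolute values; this brings it to the form that
-- `large-bound` takes.
abs-quartic : ∀ l a → ℤ.∣ + a *ℤ + a *ℤ (+ a *ℤ + a +ℤ l) ∣ ≡ a * a * ℤ.∣ + a *ℤ + a +ℤ l ∣
abs-quartic l a = trans (ℤ.abs-* (+ a *ℤ + a) _) (cong (_* ℤ.∣ + a *ℤ + a +ℤ l ∣) (ℤ.abs-* (+ a) (+ a)))

-- The extra exponent is w = v - 2u; 5u < 2v gives 4u ≤ 2v, so it is a natural number.
split-exponent : ∀ {u v} → 5 * u < 2 * v → ∃ λ w → v ≡ u + w + u
split-exponent {u} {v} 5u<2v = v ∸ (u + u) , trans (sym (m+[n∸m]≡n 2u≤v)) (eq u (v ∸ (u + u)))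
  where
  eq : ∀ u w → u + u + w ≡ u + w + u
  eq = solve-∀
  double : ∀ u → 2 * (u + u) + u ≡ 5 * u
  double = solve-∀
  2u≤v : u + u ≤ v
  2u≤v = *-cancelˡ-≤ 2 (≤-trans (≤-trans (m≤m+n (2 * (u + u)) u) (≤-reflexive (double u))) (<⇒≤ 5u<2v))

-- Here ε = u / v and the constant is c / d; the power 7v clears all denominators. Rational ε
-- suffice, since a smaller ε gives a stronger bound.
theorem4 : ABC-Conjecture →
    (l : ℤ) → l ≢ + 0 →
    (u v : ℕ) → 0 < u → 5 * u < 2 * v →
    ∃ λ (c : ℕ) → ∃ λ (d : ℕ) → 0 < c × 0 < d ×
    ((a b : ℕ) → 1 ≤ a → a < b →
    (+ a) *ℤ (+ a) *ℤ ((+ a) *ℤ (+ a) +ℤ l)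
    ℤ.∣ (+ b) *ℤ (+ b) *ℤ ((+ b) *ℤ (+ b) +ℤ l) →
    c ^ (7 * v) * a ^ (8 * v ∸ 7 * u) ≤ (d * b) ^ (7 * v))
theorem4 abc l l≢0 u v 0<u 5u<2v with split-exponent {u} {v} 5u<2v
... | w , refl with abc u (u + w) 0<u (≤-trans 0<u (m≤m+n u w))
... | K , abcK = 1 , d , s≤s z≤n , s≤s z≤n , bound
  where
  open ≤-Reasoning
  L v₀ C d : ℕ
  L = ℤ.∣ l ∣
  v₀ = u + w + u
  C = (2 * L) ^ w * (K * (16 * L) ^ v₀)
  -- `2 * L` serves small a, `C` serves large a, and the successor makes `d` positive.
  d = suc (2 * L + C)

  instance
    L≢0 : NonZero L
    L≢0 = ≢-nonZero (λ eq → l≢0 (ℤ.∣i∣≡0⇒i≡0 eq))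
    7v≢0 : NonZero (7 * v₀)
    7v≢0 = m*n≢0 7 v₀ {{it}} {{>-nonZero (≤-trans 0<u (m≤n+m u (u + w)))}}

  -- The exponent obtained, 7v + w = 8v - 2u, exceeds the claimed one by 5u.
  exponent≤ : 8 * v₀ ∸ 7 * u ≤ 7 * v₀ + w
  exponent≤ = m≤n+o⇒m∸n≤o (8 * v₀) (7 * u)
    (subst (8 * v₀ ≤_) (eq u w) (m≤m+n (8 * v₀) (5 * u)))
    where
    eq : ∀ u w → 8 * (u + w + u) + 5 * u ≡ 7 * u + (7 * (u + w + u) + w)
    eq = solve-∀

  7v+w≤2*7v : 7 * v₀ + w ≤ 7 * v₀ + 7 * v₀
  7v+w≤2*7v = +-monoʳ-≤ (7 * v₀) (≤-trans (≤-trans (m≤n+m w u) (m≤m+n (u + w) u)) (m≤m+n v₀ _))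

  m≤m^7v : ∀ m .{{_ : NonZero m}} → m ≤ m ^ (7 * v₀)
  m≤m^7v m = subst (_≤ m ^ (7 * v₀)) (^-identityʳ m) (^-monoʳ-≤ m (>-nonZero⁻¹ (7 * v₀)))

  bound : (a b : ℕ) → 1 ≤ a → a < b →
    (+ a) *ℤ (+ a) *ℤ ((+ a) *ℤ (+ a) +ℤ l) ℤ.∣ (+ b) *ℤ (+ b) *ℤ ((+ b) *ℤ (+ b) +ℤ l) →
    1 ^ (7 * v₀) * a ^ (8 * v₀ ∸ 7 * u) ≤ (d * b) ^ (7 * v₀)
  bound a b 1≤a a<b div = begin
    1 ^ (7 * v₀) * a ^ (8 * v₀ ∸ 7 * u) ≡⟨ cong (_* a ^ (8 * v₀ ∸ 7 * u)) (^-zeroˡ (7 * v₀)) ⟩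
    1 * a ^ (8 * v₀ ∸ 7 * u)            ≡⟨ *-identityˡ _ ⟩
    a ^ (8 * v₀ ∸ 7 * u)                ≤⟨ ^-monoʳ-≤ a exponent≤ ⟩
    a ^ (7 * v₀ + w)                    ≤⟨ cases (2 * L ≤? a * a) ⟩
    (d * b) ^ (7 * v₀)                  ∎
    where
    instance
      a≢0 : NonZero a
      a≢0 = >-nonZero 1≤a
      b≢0 : NonZero b
      b≢0 = >-nonZero (≤-trans (s≤s z≤n) a<b)

    cases : Dec (2 * L ≤ a * a) → a ^ (7 * v₀ + w) ≤ (d * b) ^ (7 * v₀)
    cases (yes 2L≤a²) = begin
      a ^ (7 * v₀ + w)            ≤⟨ large-bound u w K abcK {L} {a} {b} 2L≤a² a<b (shift-abs l {a} {b} L≤a² L≤b²)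
                                       (subst₂ _∣_ (abs-quartic l a) (abs-quartic l b) div) ⟩
      C * b ^ (7 * v₀)            ≤⟨ *-monoˡ-≤ (b ^ (7 * v₀)) (≤-trans C≤d (m≤m^7v d)) ⟩
      d ^ (7 * v₀) * b ^ (7 * v₀) ≡⟨ ^-distribʳ-* d b (7 * v₀) ⟨
      (d * b) ^ (7 * v₀)          ∎
      where
      C≤d : C ≤ d
      C≤d = m≤n⇒m≤1+n (m≤n+m C _)
      L≤a² : L ≤ a * a
      L≤a² = ≤-trans (m≤m+n L _) 2L≤a²
      L≤b² : L ≤ b * b
      L≤b² = ≤-trans L≤a² (*-mono-≤ (<⇒≤ a<b) (<⇒≤ a<b))
    -- Only finitely many a have a² < 2L. As w ≤ 7v, the left side is at most (a²)^(7v), and `d`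
    -- exceeds a².
    cases (no 2L≰a²) = begin
      a ^ (7 * v₀ + w)            ≤⟨ ^-monoʳ-≤ a 7v+w≤2*7v ⟩
      a ^ (7 * v₀ + 7 * v₀)       ≡⟨ ^-distribˡ-+-* a (7 * v₀) (7 * v₀) ⟩
      a ^ (7 * v₀) * a ^ (7 * v₀) ≡⟨ ^-distribʳ-* a a (7 * v₀) ⟨
      (a * a) ^ (7 * v₀)          ≤⟨ ^-monoˡ-≤ (7 * v₀) a²≤db ⟩
      (d * b) ^ (7 * v₀)          ∎
      where
      a²≤db : a * a ≤ d * b
      a²≤db = begin
        a * a                     ≤⟨ <⇒≤ (≰⇒> 2L≰a²) ⟩
        2 * L                     ≤⟨ m≤n⇒m≤1+n (m≤m+n _ C) ⟩
        d                         ≤⟨ m≤m*n d b ⟩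
        d * b                     ∎
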